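{- If $\mathbf{w}$ is an infinite $7/3$-power-free word over $\{0,1\}$, then there is a position $i$ such that $\mathbf{w}$ does not contain arbitrarily large squares beginning at position $i$ (i.e. there is a bound $N$ such that every square occurring in $\mathbf{w}$ at position $i$ has length at most $N$).
   Context: A finite word $w$ is an $\alpha$-power ($\alpha$ rational) if $w = x^n x'$ with $x$ nonempty, $x'$ a prefix of $x$, and $\alpha = n + |x'|/|x|$. A word is $\alpha$-power-free if none of its factors (contiguous subwords) is an $\alpha$-power. A square is a word $xx$ with $x$ nonempty.
   Formalization: "7/3-power-free" is taken in the standard sense: no factor is a β-power for any rational β ≥ 7/3. If only exponent exactly 7/3 were forbidden, the claim would fail for the fixed point of 0→0001, 1→0011. -}

module Defs where

open import Data.Integer.Base using (+_)
open import Data.List.Base using (List; []; _++_; length; concat; replicate; applyUpTo)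
open import Data.List.Relation.Binary.Prefix.Heterogeneous using (Prefix)
open import Data.Nat.Base using (ℕ; NonZero)
import Data.Nat.Base as ℕ
open import Data.Product.Base using (∃-syntax; _×_)
open import Data.Rational.Base using (ℚ; _/_; _+_; _≤_)
open import Relation.Binary.PropositionalEquality.Core using (_≡_; _≢_)
open import Relation.Nullary.Negation.Core using (¬_)

InfiniteWord : Set → Set
InfiniteWord A = ℕ → A

module _ {A : Set} where

  infixr 8 _^_
  _^_ : List A → ℕ → List A
  x ^ n = concat (replicate n x)

  record IsPower (α : ℚ) (u : List A) : Set where
    field
      x x′        : List A
      n           : ℕ
      {{x-nonempty}} : NonZero (length x)
      x′-prefix   : Prefix _≡_ x′ x
      u≡xⁿx′      : u ≡ x ^ n ++ x′
      α≡n+∣x′∣/∣x∣ : α ≡ + n / 1 + + length x′ / length x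

  IsSquare : List A → Set
  IsSquare u = ∃[ x ] x ≢ [] × u ≡ x ++ x

  -- Positions are numbered from 0.
  OccursAt : InfiniteWord A → ℕ → List A → Set
  OccursAt w i u = applyUpTo (λ j → w (i ℕ.+ j)) (length u) ≡ u

  IsFactor : List A → InfiniteWord A → Set
  IsFactor u w = ∃[ i ] OccursAt w i u

  -- As is standard in combinatorics on words, avoiding α-powers means avoiding
  -- all powers of exponent at least α.  Forbidding only the exponent α itself
  -- would be a different notion: no factor of 000 has exponent exactly 7/3,
  -- although 000 is a cube.
  PowerFree : ℚ → InfiniteWord A → Set
  PowerFree α w = ∀ β → α ≤ β → ∀ u → IsFactor u w → ¬ IsPower β u

{-# OPTIONS --safe #-}
-- A maximal run of alternating letters being short, avoidance of 7/3-powers forces all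
-- occurrences of 00 and 11 from position 2 onwards to have the same parity, and large
-- squares at positions 1 and 0 propagate this to the whole word.  So if large squares
-- begin at every position of v, then v is, up to a shift by one, the image of v′ = v(2n)
-- (or its complement) under the Thue–Morse morphism, and v′ inherits both hypotheses; in
-- fact a large square of v starting in the middle of a block or ending there yields an
-- overlap at position 0 of v′.  But an overlap at position 0 has even period, hence
-- descends to one of half the period in the next desubstitution: no such overlap exists.
module Submission where

open import Defs
open import Axiom.ExcludedMiddle using (ExcludedMiddle)
open import Data.Fin.Base using (Fin)
open import Data.Integer.Base using (+_)
open import Data.List.Base using (length)
open import Data.Nat.Base using (_≤_)
open import Data.Product.Base using (∃-syntax)
open import Data.Rational.Base using (_/_)
open import Level using (0ℓ)

open import Axiom.DoubleNegationElimination using (em⇒dne)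
open import Data.Empty using (⊥-elim)
open import Data.Fin.Base using (zero; suc)
open import Data.Fin.Properties using (_≟_)
import Data.Integer.Base as ℤ
import Data.Integer.Properties as ℤ
open import Data.List.Base using (List; []; _∷_; _++_; applyUpTo)
open import Data.List.Properties
  using (++-assoc; ++-identityʳ; length-++; length-applyUpTo; ∷-injective)
open import Data.List.Relation.Binary.Prefix.Heterogeneous using (Prefix; []; _∷_)
open import Data.Nat.Base
  using (ℕ; zero; suc; _+_; _*_; _<_; _∸_; z≤n; s≤s; s≤s⁻¹; NonZero; parity)
open import Data.Nat.Induction using (<-wellFounded; Acc; acc)
open import Data.Nat.Properties
  using ( +-assoc; +-comm; +-suc; +-identityʳ; +-mono-≤; m∸n+n≡m
        ; *-assoc; *-comm; *-distribʳ-+; *-monoˡ-≤; *-monoˡ-<; *-cancelʳ-≤; *-cancelʳ-<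
        ; ≤-refl; ≤-reflexive; ≤-trans; ≤-total; <⇒≤; ≰⇒>; m≤n⇒m<n∨m≡n
        ; m≤m+n; m≤n+m; m≤m*n; m<m*n; module ≤-Reasoning )
open import Data.Parity.Base as ℙ using (Parity; 0ℙ; 1ℙ; _⁻¹)
import Data.Parity.Properties as ℙ
open import Data.Product.Base using (_×_; _,_)
import Data.Rational.Base as ℚ
import Data.Rational.Properties as ℚ
import Data.Rational.Unnormalised.Base as ℚᵘ
import Data.Rational.Unnormalised.Properties as ℚᵘ
open import Data.Sum.Base using (_⊎_; inj₁; inj₂; [_,_]′)
open import Function.Base using (_∘_)
open import Relation.Binary.PropositionalEquality
  using (_≡_; _≢_; refl; sym; trans; cong; cong₂; subst; subst₂; module ≡-Reasoning)
open import Relation.Nullary using (¬_; yes; no)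

-- Binary letters and parities of positions.

Word : Set
Word = InfiniteWord (Fin 2)

-- The size of the alphabet enters the argument here.
≢-≢⇒≡ : {a b c : Fin 2} → a ≢ b → b ≢ c → a ≡ c
≢-≢⇒≡ {zero}     {zero}              a≢b _   = ⊥-elim (a≢b refl)
≢-≢⇒≡ {zero}     {suc zero} {zero}     _ _   = refl
≢-≢⇒≡ {_}        {suc zero} {suc zero} _ b≢c = ⊥-elim (b≢c refl)
≢-≢⇒≡ {suc zero} {zero}     {suc zero} _ _   = refl
≢-≢⇒≡ {_}        {zero}     {zero}     _ b≢c = ⊥-elim (b≢c refl)
≢-≢⇒≡ {suc zero} {suc zero}          a≢b _   = ⊥-elim (a≢b refl)

+-suc-suc : ∀ m n → m + suc (suc n) ≡ suc (suc (m + n))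
+-suc-suc m n = trans (+-suc m (suc n)) (cong suc (+-suc m n))

halve : ∀ n → ∃[ k ] (n ≡ k * 2 ⊎ n ≡ suc (k * 2))
halve zero = 0 , inj₁ refl
halve (suc n) with halve n
... | k , inj₁ refl = k , inj₂ refl
... | k , inj₂ refl = suc k , inj₁ refl

parity-even : ∀ k n → parity (k * 2 + n) ≡ parity n
parity-even zero    n = refl
parity-even (suc k) n = parity-even k n

parity-double : ∀ k → parity (k * 2) ≡ 0ℙ
parity-double zero    = refl
parity-double (suc k) = parity-double k

parity-odd : ∀ k → parity (suc (k * 2)) ≡ 1ℙ
parity-odd zero    = refl
parity-odd (suc k) = parity-odd k

parity≡0⇒double : ∀ p → parity p ≡ 0ℙ → ∃[ q ] p ≡ q * 2
parity≡0⇒double p p-even with halve p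
... | q , inj₁ p≡2q = q , p≡2q
... | q , inj₂ refl with () ← trans (sym p-even) (parity-odd q)

≢⇒⁻¹≡ : ∀ {d e} → d ≢ e → d ⁻¹ ≡ e
≢⇒⁻¹≡ {0ℙ} {0ℙ} d≢e = ⊥-elim (d≢e refl)
≢⇒⁻¹≡ {0ℙ} {1ℙ} _   = refl
≢⇒⁻¹≡ {1ℙ} {0ℙ} _   = refl
≢⇒⁻¹≡ {1ℙ} {1ℙ} d≢e = ⊥-elim (d≢e refl)

-- Periodicity, avoidance and block structure.

-- The factor of length p + m at position i has period p.
Periodic : Word → ℕ → ℕ → ℕ → Set
Periodic v i p m = ∀ {j} → j < m → v (j + i) ≡ v (p + (j + i))

-- Only exponents 2 + r / p with r ≤ p are excluded: every power of exponent at least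
-- 7/3 has such a prefix.
Avoids : Word → ℕ → Set
Avoids v i = ∀ p r → 0 < p → r ≤ p → p ≤ 3 * r → ¬ Periodic v i p (p + r)

-- The first letter is exempt: v(2n) may start with a letter determined by only half a block
-- of v, so avoidance at position 0 need not pass to it.
TailAvoids : Word → Set
TailAvoids v = ∀ i → Avoids v (suc i)

-- `Periodic v i p p` encodes a square at `i` whose root has length `p`.
LargeSquares : Word → Set
LargeSquares v = ∀ i N → ∃[ p ] N ≤ p × Periodic v i p p

Pair : Word → ℕ → Set
Pair v n = v n ≡ v (suc n)

-- From position s onwards v is cut into blocks 01 and 10 starting at positions of parity e.
Blocks : ℕ → Parity → Word → Set
Blocks s e v = ∀ {n} → s ≤ n → parity n ≡ e → ¬ Pair v n

-- Positions of the factors 00 and 11.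

module _ {v : Word} (avoids : TailAvoids v) where

  no-cube : ∀ i → Pair v (1 + i) → ¬ Pair v (2 + i)
  no-cube i e₁ e₂ = avoids i 1 1 (s≤s z≤n) ≤-refl (s≤s z≤n)
    λ { {0} _ → e₁ ; {1} _ → e₂ ; {suc (suc _)} (s≤s (s≤s ())) }

  -- Five alternating letters `ababa` form a 5/2-power.
  alternation⇒pair : ∀ i → ¬ Pair v (1 + i) → ¬ Pair v (2 + i) → ¬ Pair v (3 + i) → Pair v (4 + i)
  alternation⇒pair i d₁ d₂ d₃ with v (4 + i) ≟ v (5 + i)
  ... | yes e₄ = e₄
  ... | no  d₄ = ⊥-elim (avoids i 2 1 (s≤s z≤n) (s≤s z≤n) (s≤s (s≤s z≤n))
    λ { {0} _ → ≢-≢⇒≡ d₁ d₂ ; {1} _ → ≢-≢⇒≡ d₂ d₃ ; {2} _ → ≢-≢⇒≡ d₃ d₄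
      ; {suc (suc (suc _))} (s≤s (s≤s (s≤s ()))) })

  some-pair : ∀ i → ∃[ j ] j < 4 × Pair v (suc j + i)
  some-pair i with v (1 + i) ≟ v (2 + i) | v (2 + i) ≟ v (3 + i) | v (3 + i) ≟ v (4 + i)
  ... | yes e₁ | _      | _      = 0 , s≤s z≤n , e₁
  ... | no  _  | yes e₂ | _      = 1 , s≤s (s≤s z≤n) , e₂
  ... | no  _  | no  _  | yes e₃ = 2 , s≤s (s≤s (s≤s z≤n)) , e₃
  ... | no  d₁ | no  d₂ | no  d₃ = 3 , ≤-refl , alternation⇒pair i d₁ d₂ d₃

  -- Otherwise aabaa occurs, extending to the 7/3-power baabaab.
  no-pair-3 : ∀ i → Pair v (2 + i) → ¬ Pair v (5 + i)
  no-pair-3 i e₂ e₅ = avoids i 3 1 (s≤s z≤n) (s≤s z≤n) ≤-refl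
    λ { {0} _ → ≢-≢⇒≡ (λ e₁ → no-cube i e₁ e₂) d₂₄
      ; {1} _ → trans e₂ (≢-≢⇒≡ d₃ d₄)
      ; {2} _ → trans (≢-≢⇒≡ d₃ d₄) e₅
      ; {3} _ → ≢-≢⇒≡ d₄ (λ e₅₇ → no-cube (4 + i) e₅ (trans (sym e₅) e₅₇))
      ; {suc (suc (suc (suc _)))} (s≤s (s≤s (s≤s (s≤s ())))) }
    where
    d₃ : ¬ Pair v (3 + i)
    d₃ = no-cube (1 + i) e₂
    d₂₄ : v (2 + i) ≢ v (4 + i)
    d₂₄ e = d₃ (trans (sym e₂) e)
    d₄ : ¬ Pair v (4 + i)
    d₄ e₄ = no-cube (3 + i) e₄ e₅

  -- Distance 1 makes a cube, distance 3 is excluded, and a distance above 4 leaves an alternating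
  -- run of five letters.
  next-pair : ∀ i → Pair v (2 + i) → Pair v (4 + i) ⊎ Pair v (6 + i)
  next-pair i e₂ with v (4 + i) ≟ v (5 + i)
  ... | yes e₄ = inj₁ e₄
  ... | no  d₄ = inj₂ (alternation⇒pair (2 + i) (no-cube (1 + i) e₂) d₄ (no-pair-3 i e₂))

  -- Moving from the first pair to the next, 2 or 4 places on, shortens the distance and keeps it
  -- odd, until it is 1 or 3.
  no-pair-odd : ∀ k i → Pair v (2 + i) → ¬ Pair v (suc (k * 2 + (2 + i)))
  no-pair-odd 0 i e = no-cube (1 + i) e
  no-pair-odd 1 i e = no-pair-3 i e
  no-pair-odd (suc (suc k)) i e e′ =
    [ (λ e₄ → no-pair-odd (suc k) (2 + i) e₄ (subst (Pair v ∘ suc) (sym eq₄) e′))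
    , (λ e₆ → no-pair-odd k (4 + i) e₆ (subst (Pair v ∘ suc) (sym eq₆) e′))
    ]′ (next-pair i e)
    where
    eq₄ : suc k * 2 + (4 + i) ≡ suc (suc k) * 2 + (2 + i)
    eq₄ = +-suc-suc (suc k * 2) (2 + i)
    eq₆ : k * 2 + (6 + i) ≡ suc (suc k) * 2 + (2 + i)
    eq₆ = trans (+-suc-suc (k * 2) (4 + i)) (cong (λ n → 2 + n) (+-suc-suc (k * 2) (2 + i)))

  pairs-parity-≤ : ∀ {i n} → 2 ≤ i → i ≤ n → Pair v i → Pair v n → parity n ≡ parity i
  pairs-parity-≤ {i@(suc (suc i′))} {n} _ i≤n e e′ with halve (n ∸ i)
  ... | k , inj₁ eq = trans (cong parity (trans (sym (m∸n+n≡m i≤n)) (cong (λ d → d + i) eq))) (parity-even k i)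
  ... | k , inj₂ eq =
    ⊥-elim (no-pair-odd k i′ e (subst (Pair v) (trans (sym (m∸n+n≡m i≤n)) (cong (λ d → d + i) eq)) e′))
  pairs-parity-≤ {suc zero} (s≤s ())

  pairs-parity : ∀ {i n} → 2 ≤ i → 2 ≤ n → Pair v i → Pair v n → parity n ≡ parity i
  pairs-parity {i} {n} 2≤i 2≤n e e′ with ≤-total i n
  ... | inj₁ i≤n = pairs-parity-≤ 2≤i i≤n e e′
  ... | inj₂ n≤i = sym (pairs-parity-≤ 2≤n n≤i e′ e)

  -- Blocks start at the parity opposite to that of the pairs. The start is 2 because `no-pair-3`
  -- extends its factor one letter to the left and avoidance begins at position 1.
  blocks-from-2 : ∃[ e ] Blocks 2 e v
  blocks-from-2 with some-pair 1
  ... | j , _ , e = parity (suc j + 1) ⁻¹ , λ 2≤n n≡ e′ →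
    ℙ.p≢p⁻¹ _ (trans (sym (pairs-parity 2≤i 2≤n e e′)) n≡)
    where
    2≤i : 2 ≤ suc j + 1
    2≤i = s≤s (m≤n+m 1 j)

-- Parity of periods, and blocks from position 0.

parity-shift-odd : ∀ {p e n} → parity p ≡ 1ℙ → parity n ≢ e → parity (p + n) ≡ e
parity-shift-odd {p} {e} {n} p-odd n≢e =
  trans (ℙ.+-homo-+ p n) (trans (cong (ℙ._+ parity n) p-odd) (≢⇒⁻¹≡ n≢e))

parity-shift-even : ∀ {p e n} → parity p ≡ 0ℙ → parity n ≡ e → parity (p + n) ≡ e
parity-shift-even {p} {e} {n} p-even n≡e =
  trans (ℙ.+-homo-+ p n) (trans (cong (ℙ._+ parity n) p-even) n≡e)

-- An odd period copies a pair to a position of the other parity, so one of the two copies lies on a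
-- block.
odd-period⇒alternating : ∀ {v s e p i m} → Blocks s e v → parity p ≡ 1ℙ → Periodic v i p m →
  ∀ {j} → suc j < m → s ≤ j + i → ¬ Pair v (j + i)
odd-period⇒alternating {v} {s} {e} {p} {i} blocks p-odd per {j} j<m s≤ pair
  with parity (j + i) ℙ.≟ e
... | yes ≡e = blocks s≤ ≡e pair
... | no  ≢e = blocks (≤-trans s≤ (m≤n+m (j + i) p)) (parity-shift-odd {p} p-odd ≢e) (begin
  v (p + (j + i))       ≡⟨ per (<⇒≤ j<m) ⟨
  v (j + i)             ≡⟨ pair ⟩
  v (suc j + i)         ≡⟨ per j<m ⟩
  v (p + suc (j + i))   ≡⟨ cong v (+-suc p (j + i)) ⟩
  v (suc (p + (j + i))) ∎)
  where open ≡-Reasoning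

-- Some pair starts at one of the positions `i + 1` to `i + 4`; a root of length 6 contains both of
-- its letters.
large-square-even : ∀ {v e i p} → TailAvoids v → Blocks (suc i) e v → 6 ≤ p → Periodic v i p p →
  parity p ≡ 0ℙ
large-square-even {v} {e} {i} {p} avoids blocks 6≤p per with parity p in p≡
... | 0ℙ = refl
... | 1ℙ with j , j<4 , pair ← some-pair {v} avoids i =
  ⊥-elim (odd-period⇒alternating {v} {p = p} {i} blocks p≡ per (≤-trans (s≤s (s≤s j<4)) 6≤p) (s≤s (m≤n+m i j)) pair)

-- The even period of a large square at `n` would copy a pair at `n` to a later position of the same
-- parity, where blocks are already known.
blocks-extend : ∀ {v s e} → TailAvoids v → LargeSquares v → Blocks (suc s) e v → Blocks s e v
blocks-extend {v} {s} {e} avoids squares blocks {n} s≤n n≡e pair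
  with p , 6≤p , per ← squares n 6 =
  blocks (≤-trans (s≤s s≤n) (+-mono-≤ 1≤p ≤-refl)) (parity-shift-even {p} p-even n≡e) (begin
    v (p + n)       ≡⟨ per 1≤p ⟨
    v n             ≡⟨ pair ⟩
    v (suc n)       ≡⟨ per (≤-trans (s≤s (s≤s z≤n)) 6≤p) ⟩
    v (p + suc n)   ≡⟨ cong v (+-suc p n) ⟩
    v (suc (p + n)) ∎)
  where
  open ≡-Reasoning
  1≤p : 1 ≤ p
  1≤p = ≤-trans (s≤s z≤n) 6≤p
  p-even : parity p ≡ 0ℙ
  p-even = large-square-even {v} avoids (λ {m} 1+n≤ → blocks {m} (≤-trans (s≤s s≤n) 1+n≤)) 6≤p per

record Good (v : Word) : Set where
  field
    avoids  : TailAvoids v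
    squares : LargeSquares v

  blocks : ∃[ e ] Blocks 0 e v
  blocks with e , b ← blocks-from-2 avoids =
    e , blocks-extend avoids squares (blocks-extend avoids squares b)

  even-square : ∀ i N → ∃[ q ] N ≤ q × Periodic v i (q * 2) (q * 2)
  even-square i N
    with e , b ← blocks
    -- The 6 forces an even period; `N * 2` leaves at least `N` after halving.
    with p , N≤p , per ← squares i (6 + N * 2)
    with q , refl ← parity≡0⇒double p
           (large-square-even {v} avoids (λ {n} _ → b {n} z≤n) (≤-trans (m≤m+n 6 (N * 2)) N≤p) per) =
    q , *-cancelʳ-≤ N q 2 (≤-trans (m≤n+m (N * 2) 6) N≤p) , per

-- Desubstitution of the Thue-Morse morphism.

evens : Word → Word
evens v n = v (n * 2)

periodic-evens : ∀ {v i p l m} → (∀ {j} → j < m → j * 2 < l) →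
  Periodic v (i * 2) (p * 2) l → Periodic (evens v) i p m
periodic-evens {v} {i} {p} bound per {j} j<m = begin
  v ((j + i) * 2)             ≡⟨ cong v (*-distribʳ-+ 2 j i) ⟩
  v (j * 2 + i * 2)           ≡⟨ per (bound j<m) ⟩
  v (p * 2 + (j * 2 + i * 2)) ≡⟨ cong (λ n → v (p * 2 + n)) (*-distribʳ-+ 2 j i) ⟨
  v (p * 2 + (j + i) * 2)     ≡⟨ cong v (*-distribʳ-+ 2 p (j + i)) ⟨
  v ((p + (j + i)) * 2)       ∎
  where open ≡-Reasoning

module _ {e v} (blocks : Blocks 0 e v) where

  block-second : ∀ {m n} → parity m ≡ e → parity n ≡ e → v m ≡ v n → v (suc m) ≡ v (suc n)
  block-second m≡e n≡e eq =
    ≢-≢⇒≡ (λ eq′ → blocks z≤n m≡e (sym eq′)) (λ eq′ → blocks z≤n n≡e (trans (sym eq) eq′))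

  block-first : ∀ {m n} → parity m ≡ e → parity n ≡ e → v (suc m) ≡ v (suc n) → v m ≡ v n
  block-first m≡e n≡e eq =
    ≢-≢⇒≡ (blocks z≤n m≡e) (λ eq′ → blocks z≤n n≡e (trans (sym eq′) eq))

  -- The second letter of a block determines the first, and an even period maps blocks to blocks.
  extend-left : ∀ {i q m} → parity i ≡ e → Periodic v (suc i) (q * 2) (suc m) →
    Periodic v i (q * 2) (suc (suc m))
  extend-left {i} {q} i≡e per {zero} _ =
    block-first i≡e (trans (parity-even q i) i≡e) (trans (per (s≤s z≤n)) (cong v (+-suc (q * 2) i)))
  extend-left {i} {q} i≡e per {suc j} (s≤s j<) =
    subst (λ n → v n ≡ v (q * 2 + n)) (+-suc j i) (per j<)

  extend-right : ∀ {i q m} → parity (m + i) ≡ e → Periodic v i (q * 2) (suc m) →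
    Periodic v i (q * 2) (suc (suc m))
  extend-right {i} {q} {m} ≡e per {j} (s≤s j≤) with m≤n⇒m<n∨m≡n j≤
  ... | inj₁ j< = per j<
  ... | inj₂ refl = trans
    (block-second ≡e (trans (parity-even q (m + i)) ≡e) (per ≤-refl))
    (cong v (sym (+-suc (q * 2) (m + i))))

periodic-evens⁻¹ : ∀ {v i p m} → Periodic (evens v) i p m →
  ∀ {k} → k < m → v (k * 2 + i * 2) ≡ v (p * 2 + (k * 2 + i * 2))
periodic-evens⁻¹ {v} {i} {p} per {k} k<m = begin
  v (k * 2 + i * 2)           ≡⟨ cong v (*-distribʳ-+ 2 k i) ⟨
  v ((k + i) * 2)             ≡⟨ per k<m ⟩
  v ((p + (k + i)) * 2)       ≡⟨ cong v (*-distribʳ-+ 2 p (k + i)) ⟩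
  v (p * 2 + (k + i) * 2)     ≡⟨ cong (λ n → v (p * 2 + n)) (*-distribʳ-+ 2 k i) ⟩
  v (p * 2 + (k * 2 + i * 2)) ∎
  where open ≡-Reasoning

-- Each compared letter stands for a whole block. The start `suc i` is positive because for `e = 1ℙ`
-- its block begins one place before `suc i * 2`.
periodic-double : ∀ {e v} → Blocks 0 e v → ∀ {i p m} → Periodic (evens v) (suc i) p m →
  ∃[ i′ ] Periodic v (suc i′) (p * 2) (m * 2)
periodic-double {0ℙ} {v} blocks {i} {p} {m} per = suc (i * 2) , doubled
  where
  doubled : Periodic v (suc i * 2) (p * 2) (m * 2)
  doubled {j} j< with halve j
  ... | k , inj₁ refl = periodic-evens⁻¹ {v} {suc i} {p} per (*-cancelʳ-< 2 k m j<)
  ... | k , inj₂ refl = trans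
    (block-second blocks n-even (trans (parity-even p _) n-even)
      (periodic-evens⁻¹ {v} {suc i} {p} per (*-cancelʳ-< 2 k m (<⇒≤ j<))))
    (cong v (sym (+-suc (p * 2) (k * 2 + suc i * 2))))
    where
    n-even : parity (k * 2 + suc i * 2) ≡ 0ℙ
    n-even = trans (parity-even k (suc i * 2)) (parity-double i)
periodic-double {1ℙ} {v} blocks {i} {p} {m} per = i * 2 , doubled
  where
  doubled : Periodic v (suc (i * 2)) (p * 2) (m * 2)
  doubled {j} j< with halve j
  ... | k , inj₂ refl = subst (λ n → v n ≡ v (p * 2 + n)) (+-suc (k * 2) (suc (i * 2)))
    (periodic-evens⁻¹ {v} {suc i} {p} per (*-cancelʳ-< 2 k m (<⇒≤ j<)))
  ... | k , inj₁ refl = block-first blocks n-odd (trans (parity-even p _) n-odd)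
    (subst₂ (λ a b → v a ≡ v b) (+-suc (k * 2) (suc (i * 2)))
      (trans (cong (λ n → p * 2 + n) (+-suc (k * 2) (suc (i * 2)))) (+-suc (p * 2) _))
      (periodic-evens⁻¹ {v} {suc i} {p} per (*-cancelʳ-< 2 k m j<)))
    where
    n-odd : parity (k * 2 + suc (i * 2)) ≡ 1ℙ
    n-odd = trans (parity-even k (suc (i * 2))) (parity-odd i)

-- A forbidden power in `evens v` expands to one of the same exponent in `v`; squares of even period
-- at even positions are halved.
good-evens : ∀ {v} → Good v → Good (evens v)
good-evens {v} good with e , b ← Good.blocks good = record
  { avoids = λ i p r 0<p r≤p p≤3r per →
      let i′ , per′ = periodic-double b {i} {p} per in
      Good.avoids good i′ (p * 2) (r * 2) (≤-trans 0<p (m≤m*n p 2)) (*-monoˡ-≤ 2 r≤p)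
        (subst (p * 2 ≤_) (*-assoc 3 r 2) (*-monoˡ-≤ 2 p≤3r))
        (subst (Periodic v (suc i′) (p * 2)) (*-distribʳ-+ 2 p r) (λ {j} → per′ {j}))
  ; squares = λ i N → let q , N≤q , per = Good.even-square good (i * 2) N in
      q , N≤q , periodic-evens {v} {i} {q} (*-monoˡ-< 2) per
  }

-- Overlaps at position 0.

alternating⇒≡-even-shift : ∀ {v : Word} {i l} → (∀ {j} → j < l → ¬ Pair v (j + i)) →
  ∀ k → k * 2 ≤ l → v (k * 2 + i) ≡ v i
alternating⇒≡-even-shift alt zero    _  = refl
alternating⇒≡-even-shift {v} {i} alt (suc k) k≤ = trans
  (sym (≢-≢⇒≡ (alt (<⇒≤ k≤)) (alt k≤)))
  (alternating⇒≡-even-shift {v} {i} alt k (<⇒≤ (<⇒≤ k≤)))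

no-overlap : ∀ {v p} → Good v → 0 < p → ¬ Periodic v 0 p (suc p)
no-overlap {v} {p} = go v p (<-wellFounded p)
  where
  go : ∀ v p → Acc _<_ p → Good v → 0 < p → ¬ Periodic v 0 p (suc p)
  go v p (acc rec) good 0<p per with e , b ← Good.blocks good | halve p
  ... | suc q , inj₁ refl =
    go (evens v) (suc q) (rec (m<m*n (suc q) 2 ≤-refl)) (good-evens good) (s≤s z≤n)
      (periodic-evens {v} {0} {suc q} (λ j<1+q → s≤s (*-monoˡ-≤ 2 (s≤s⁻¹ j<1+q))) per)
  ... | zero , inj₁ refl with () ← 0<p
  -- For `p = 2q + 1`, alternation gives `v(2q) = v(0)` and the period gives `v(0) = v(2q + 1)`. The
  -- extra letter of the overlap lets alternation reach this pair at `2q`.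
  ... | q , inj₂ refl = alt ≤-refl
    (trans (alternating⇒≡-even-shift {v} {0} alt q (<⇒≤ ≤-refl))
      (per (s≤s z≤n)))
    where
    alt : ∀ {j} → j < suc (q * 2) → ¬ Pair v (j + 0)
    alt j< = odd-period⇒alternating {v} {p = p} {0} b (parity-odd q) per (s≤s j<) z≤n

-- With blocks at even positions, a square at 1 starts inside a block and gains the letter at 0.
-- With blocks at odd positions, a square at 0 ends inside a block and gains the letter after it.
evens-overlap : ∀ {v} → Good v → ∃[ q ] 0 < q × Periodic (evens v) 0 q (suc q)
evens-overlap {v} good with Good.blocks good
... | 0ℙ , b with suc q , _ , per ← Good.even-square good 1 1 =
  suc q , s≤s z≤n , periodic-evens {v} {0} {suc q} (λ j<1+q → s≤s (*-monoˡ-≤ 2 (s≤s⁻¹ j<1+q)))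
    (extend-left b {0} {suc q} refl per)
... | 1ℙ , b with suc q , _ , per ← Good.even-square good 0 1 =
  suc q , s≤s z≤n , periodic-evens {v} {0} {suc q} (λ j<1+q → s≤s (*-monoˡ-≤ 2 (s≤s⁻¹ j<1+q)))
    (extend-right b {0} {suc q} (trans (cong (λ n → parity (suc n)) (+-identityʳ (q * 2))) (parity-odd q)) per)

¬good : ∀ {v} → ¬ Good v
¬good good with q , 0<q , per ← evens-overlap good = no-overlap (good-evens good) 0<q per

-- Translation between finite factors and periodicity.

module _ {A : Set} where

  applyUpTo-+ : ∀ (f : ℕ → A) m n →
    applyUpTo f (m + n) ≡ applyUpTo f m ++ applyUpTo (λ j → f (m + j)) n
  applyUpTo-+ f zero    n = refl
  applyUpTo-+ f (suc m) n = cong (f 0 ∷_) (applyUpTo-+ (f ∘ suc) m n)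

  applyUpTo-cong : ∀ {f g : ℕ → A} n → (∀ {j} → j < n → f j ≡ g j) → applyUpTo f n ≡ applyUpTo g n
  applyUpTo-cong zero    f≗g = refl
  applyUpTo-cong (suc n) f≗g = cong₂ _∷_ (f≗g (s≤s z≤n)) (applyUpTo-cong n (f≗g ∘ s≤s))

  applyUpTo-injective : ∀ {f g : ℕ → A} n → applyUpTo f n ≡ applyUpTo g n → ∀ {j} → j < n → f j ≡ g j
  applyUpTo-injective (suc n) eq {zero}  _        with eq₀ , _ ← ∷-injective eq = eq₀
  applyUpTo-injective (suc n) eq {suc j} (s≤s j<) with _ , eq₊ ← ∷-injective eq =
    applyUpTo-injective n eq₊ j<

  applyUpTo-prefix : ∀ (f : ℕ → A) {m n} → m ≤ n → Prefix _≡_ (applyUpTo f m) (applyUpTo f n)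
  applyUpTo-prefix f z≤n       = []
  applyUpTo-prefix f (s≤s m≤n) = refl ∷ applyUpTo-prefix (f ∘ suc) m≤n

  applyUpTo≡++ : ∀ (f : ℕ → A) x {y n} → applyUpTo f (length x + n) ≡ x ++ y →
    applyUpTo f (length x) ≡ x × applyUpTo (λ j → f (length x + j)) n ≡ y
  applyUpTo≡++ f []      eq = refl , eq
  applyUpTo≡++ f (a ∷ x) eq
    with f0≡a , eq₊ ← ∷-injective eq
    with eqˣ , eqʸ ← applyUpTo≡++ (f ∘ suc) x eq₊ = cong₂ _∷_ f0≡a eqˣ , eqʸ

7/3≤2+r/p : ∀ p .{{_ : NonZero p}} r → p ≤ 3 * r → + 7 / 3 ℚ.≤ + 2 / 1 ℚ.+ + r / p
-- `+ 7 / 3` evaluates to the sum of 2 and 1/3, which leaves 1/3 ≤ r/p.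
7/3≤2+r/p p@(suc p-1) r p≤3r = ℚ.+-monoʳ-≤ (+ 2 / 1) {+ 1 / 3} (ℚ.toℚᵘ-cancel-≤ (begin
  ℚ.toℚᵘ (+ 1 / 3)   ≃⟨ ℚ.toℚᵘ-fromℚᵘ (ℚᵘ.mkℚᵘ (+ 1) 2) ⟩
  ℚᵘ.mkℚᵘ (+ 1) 2    ≤⟨ ℚᵘ.*≤* (subst₂ ℤ._≤_ (ℤ.pos-* 1 p) (ℤ.pos-* r 3)
                         (ℤ.+≤+ (≤-trans (≤-reflexive (+-identityʳ p)) (≤-trans p≤3r (≤-reflexive (*-comm 3 r)))))) ⟩
  ℚᵘ.mkℚᵘ (+ r) p-1  ≃⟨ ℚ.toℚᵘ-fromℚᵘ (ℚᵘ.mkℚᵘ (+ r) p-1) ⟨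
  ℚ.toℚᵘ (+ r / p)   ∎))
  where open ℚᵘ.≤-Reasoning

powerFree⇒avoids : ∀ {w} → PowerFree (+ 7 / 3) w → ∀ i → Avoids w i
powerFree⇒avoids {w} free i p@(suc _) r 0<p r≤p p≤3r per =
  free (+ 2 / 1 ℚ.+ + r / p) (7/3≤2+r/p p r p≤3r) u (i , occurs) power
  where
  f : ℕ → Fin 2
  f j = w (i + j)
  x x′ u : List (Fin 2)
  x  = applyUpTo f p
  x′ = applyUpTo f r
  u  = applyUpTo f (p + (p + r))

  occurs : OccursAt w i u
  occurs = cong (applyUpTo f) (length-applyUpTo f (p + (p + r)))

  shift : ∀ {j} → j < p + r → f (p + j) ≡ f j
  shift {j} j< = begin
    w (i + (p + j)) ≡⟨ cong w (trans (+-comm i (p + j)) (+-assoc p j i)) ⟩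
    w (p + (j + i)) ≡⟨ per j< ⟨
    w (j + i)       ≡⟨ cong w (+-comm j i) ⟩
    w (i + j)       ∎
    where open ≡-Reasoning

  u≡x²x′ : u ≡ (x ^ 2) ++ x′
  u≡x²x′ = begin
    u                                            ≡⟨ applyUpTo-+ f p (p + r) ⟩
    x ++ applyUpTo (λ j → f (p + j)) (p + r)     ≡⟨ cong (x ++_) (applyUpTo-cong (p + r) shift) ⟩
    x ++ applyUpTo f (p + r)                     ≡⟨ cong (x ++_) (applyUpTo-+ f p r) ⟩
    x ++ (x ++ applyUpTo (λ j → f (p + j)) r)    ≡⟨ cong (λ y → x ++ (x ++ y))
                                                      (applyUpTo-cong r (λ j<r → shift (≤-trans j<r (m≤n+m r p)))) ⟩
    x ++ (x ++ x′)                               ≡⟨ ++-assoc x x x′ ⟨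
    (x ++ x) ++ x′                               ≡⟨ cong (λ y → (x ++ y) ++ x′) (++-identityʳ x) ⟨
    (x ^ 2) ++ x′                                ∎
    where open ≡-Reasoning

  power : IsPower (+ 2 / 1 ℚ.+ + r / p) u
  power = record
    { x = x ; x′ = x′ ; n = 2
    ; x′-prefix = applyUpTo-prefix f r≤p
    ; u≡xⁿx′ = u≡x²x′
    ; α≡n+∣x′∣/∣x∣ = cong (+ 2 / 1 ℚ.+_)
        (ℚ./-cong (cong +_ (sym (length-applyUpTo f r))) (sym (length-applyUpTo f p)))
    }

square⇒periodic : ∀ {w : Word} {i} x → OccursAt w i (x ++ x) → Periodic w i (length x) (length x)
square⇒periodic {w} {i} x occ {j} j<
  with eq₁ , eq₂ ← applyUpTo≡++ (λ j → w (i + j)) x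
         (subst (λ n → applyUpTo (λ j → w (i + j)) n ≡ x ++ x) (length-++ x) occ) = begin
  w (j + i)                ≡⟨ cong w (+-comm j i) ⟩
  w (i + j)                ≡⟨ applyUpTo-injective (length x) (trans eq₁ (sym eq₂)) j< ⟩
  w (i + (length x + j))   ≡⟨ cong w (trans (+-comm i (length x + j)) (+-assoc (length x) j i)) ⟩
  w (length x + (j + i))   ∎
  where open ≡-Reasoning

theorem5 : ExcludedMiddle 0ℓ → (w : InfiniteWord (Fin 2)) → PowerFree (+ 7 / 3) w →
    ∃[ i ] ∃[ N ] (∀ u → IsSquare u → OccursAt w i u → length u ≤ N)
theorem5 em w free = dne λ unbounded → ¬good {w} record
  { avoids  = powerFree⇒avoids {w} free ∘ suc
  -- If every square at `i` had a root shorter than `N`, then `N * 2` would bound their lengths.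
  ; squares = λ i N → dne λ small → unbounded (i , N * 2 , λ where
      u (x , _ , refl) occ → bound x N (λ N≤ → small (length x , N≤ , square⇒periodic {w} {i} x occ)))
  }
  where
  dne : ∀ {P : Set} → ¬ ¬ P → P
  dne = em⇒dne em
  bound : ∀ (x : List (Fin 2)) N → ¬ N ≤ length x → length (x ++ x) ≤ N * 2
  bound x N N≰ = begin
    length (x ++ x)          ≡⟨ length-++ x ⟩
    length x + length x      ≤⟨ +-mono-≤ (<⇒≤ (≰⇒> N≰)) (<⇒≤ (≰⇒> N≰)) ⟩
    N + N                    ≡⟨ cong (λ n → N + n) (+-identityʳ N) ⟨
    2 * N                    ≡⟨ *-comm 2 N ⟩
    N * 2                    ∎
    where open ≤-Reasoning
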